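{- For any $l,m,n\in\mathbb{N}$ (positive integers), $K_{l,m,n}\in\mathfrak{N}_{c}$ and $w_{c}(K_{l,m,n})\leq l+m+n$.
   Context: $K_{l,m,n}$ is the complete tripartite graph with parts of sizes $l$, $m$ and $n$. For a finite simple graph $G$ and a positive integer $t$, an interval cyclic $t$-coloring of $G$ is a proper edge-coloring of $G$ with colors $1,\ldots,t$ such that all $t$ colors are used and, for each vertex $v$, the edges incident to $v$ are colored by $d_{G}(v)$ consecutive colors modulo $t$ (i.e. consecutive in the cyclic order $1,2,\ldots,t,1$), where $d_G(v)$ is the degree of $v$. $\mathfrak{N}_{c}$ is the set of graphs having an interval cyclic $t$-coloring for some positive integer $t$. For $G\in\mathfrak{N}_{c}$, $w_{c}(G)$ is the least $t$ for which $G$ has an interval cyclic $t$-coloring. -}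

module Defs where

open import Data.Fin using (Fin; toℕ; splitAt)
open import Data.Fin.Properties using () renaming (_≟_ to _≟ᶠ_)
open import Data.Fin.Patterns using (0F; 1F; 2F)
open import Data.Nat using (ℕ; _+_; _%_; _≤_; _<_; NonZero)
open import Data.Product using (Σ-syntax; ∃-syntax; _×_)
open import Data.Sum using ([_,_]′)
open import Data.Vec using (allFin; count)
open import Function using (const; _∘_; _⇔_)
open import Level using (0ℓ)
open import Relation.Binary using (Rel; Decidable; Symmetric; Irreflexive)
open import Relation.Binary.PropositionalEquality using (_≡_; _≢_; refl; sym)
open import Relation.Nullary.Decidable using (¬?)
open import Relation.Unary using (Pred)

record Graph : Set₁ where
  field
    order  : ℕ
    Adj    : Rel (Fin order) 0ℓ
    adj?   : Decidable Adj
    symm   : Symmetric Adj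
    irrefl : Irreflexive _≡_ Adj

  Vertex : Set
  Vertex = Fin order

  degree : Vertex → ℕ
  degree v = count (adj? v) (allFin order)

part : ∀ l m n → Fin (l + m + n) → Fin 3
part l m n = [ [ const 0F , const 1F ]′ ∘ splitAt l , const 2F ]′ ∘ splitAt (l + m)

completeTripartite : ℕ → ℕ → ℕ → Graph
completeTripartite l m n = record
  { order  = l + m + n
  ; Adj    = λ u v → part l m n u ≢ part l m n v
  ; adj?   = λ u v → ¬? (part l m n u ≟ᶠ part l m n v)
  ; symm   = λ u≁v → u≁v ∘ sym
  ; irrefl = λ { refl u≁u → u≁u refl }
  }

-- The colours 1, …, t are represented by the elements 0, …, t - 1 of Fin t.
-- An undirected edge is presented by either of its orientations together with
-- a proof of adjacency; colour-symm makes the colour depend on the edge only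
-- (applied twice, it also gives independence of the adjacency proof).
record EdgeColouring (G : Graph) (t : ℕ) : Set where
  open Graph G
  field
    colour      : ∀ u v → Adj u v → Fin t
    colour-symm : ∀ u v (e : Adj u v) (e′ : Adj v u) → colour u v e ≡ colour v u e′

module _ {G : Graph} {t : ℕ} (α : EdgeColouring G t) where
  open Graph G
  open EdgeColouring α

  Proper : Set
  Proper = ∀ u v w (e : Adj u v) (f : Adj u w) → v ≢ w → colour u v e ≢ colour u w f

  UsesAllColours : Set
  UsesAllColours = ∀ c → ∃[ u ] ∃[ v ] Σ[ e ∈ Adj u v ] colour u v e ≡ c

  AppearsAt : Vertex → Fin t → Set
  AppearsAt v c = ∃[ u ] Σ[ e ∈ Adj v u ] colour v u e ≡ c

  -- The colours at v are exactly s, s + 1, …, s + d(v) - 1 modulo t.  For a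
  -- proper colouring d(v) ≤ t, so these are d(v) different colours.
  CyclicallyConsecutiveAt : .{{_ : NonZero t}} → Vertex → Set
  CyclicallyConsecutiveAt v =
    ∃[ s ] (∀ c → AppearsAt v c ⇔
      (∃[ i ] i < degree v × toℕ c ≡ (toℕ {t} s + i) % t))

record IsIntervalCyclic {G : Graph} {t : ℕ} .{{_ : NonZero t}}
                        (α : EdgeColouring G t) : Set where
  field
    proper      : Proper α
    allUsed     : UsesAllColours α
    consecutive : ∀ v → CyclicallyConsecutiveAt α v

HasIntervalCyclicColouring : Graph → ℕ → Set
HasIntervalCyclicColouring G t =
  Σ[ t≢0 ∈ NonZero t ] Σ[ α ∈ EdgeColouring G t ] IsIntervalCyclic {{t≢0}} α

𝔑c : Pred Graph 0ℓ
𝔑c G = ∃[ t ] HasIntervalCyclicColouring G t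

-- The minimum w_c as a functional relation: wc[ G ]≔ w holds for at most one w.
wc[_]≔_ : Graph → ℕ → Set
wc[ G ]≔ w = HasIntervalCyclicColouring G w
            × (∀ t → HasIntervalCyclicColouring G t → w ≤ t)

{-# OPTIONS --safe #-}
module Submission where

-- Number the vertices of K = K_{l,m,n} consecutively, part after part, by
-- 0, …, N - 1 with N = l + m + n, and colour the edge uv by u + v modulo N:
-- the edge colours are the off-diagonal blocks of the addition table of ℤ/N.
--
-- * Rows of the addition table have no repetitions, so the colouring is proper.
-- * The non-neighbours of a vertex v form an interval [a, b) of 0, …, N - 1,
--   namely the part of v.  Its neighbours are thus b, b + 1, …, N - 1, 0, …,
--   a - 1, which are cyclically consecutive, and translation by v keeps them
--   so: the colours at v are v + b, v + b + 1, … (additive-consecutive).  This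
--   works in every graph whose vertices all have an interval of
--   non-neighbours.
-- * A colour c ≥ l occurs on the edge joining 0 to c, and a colour c < l on the
--   edge joining N - 1 to c + 1 (tripartite-allUsed).
--
-- So K has an interval cyclic N-colouring.  The existence of a least number of
-- colours also needs, constructively, that having an interval cyclic
-- t-colouring is decidable.  This is an exhaustive search: up to pointwise
-- equality an edge colouring is one of finitely many tables of colours
-- (hasIntervalCyclicColouring?).

open import Defs
open import Data.Fin using (Fin; zero; suc; toℕ; fromℕ<; finToFun; funToFin)
open import Data.Fin.Patterns using (0F; 1F; 2F)
open import Data.Fin.Properties
  using (any?; all?; toℕ-injective; toℕ-fromℕ<; toℕ<n; finToFun-funToFin; splitAt-<; splitAt-≥)
  renaming (_≟_ to _≟ᶠ_)
open import Data.Nat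
  using (ℕ; zero; suc; _+_; _∸_; _^_; _%_; _≤_; _<_; z≤n; s≤s; s≤s⁻¹; NonZero;
         ≢-nonZero⁻¹; >-nonZero; >-nonZero⁻¹; pred)
open import Data.Nat.DivMod using (_mod_; m%n<n; m%n%n≡m%n; [m+n]%n≡m%n; m<n⇒m%n≡m; %-distribˡ-+)
open import Data.Nat.Induction using (<-rec)
open import Data.Nat.Properties
open import Data.Product using (Σ; Σ-syntax; ∃; ∃-syntax; _×_; _,_; proj₁; proj₂)
open import Data.Sum using (_⊎_; inj₁; inj₂)
open import Data.Vec using (tabulate; count)
open import Function using (_∘_; id; _⇔_; mk⇔; Equivalence)
open import Relation.Binary.PropositionalEquality
  using (_≡_; _≢_; refl; sym; trans; cong; cong₂; subst; module ≡-Reasoning)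
open import Relation.Nullary using (Dec; yes; no; ¬_; contradiction)
open import Relation.Nullary.Decidable
  using (map′; ¬?; _×-dec_; _→-dec_; dec-true; dec-false)
open import Relation.Unary using (Decidable; _∈_)

open Graph
open EdgeColouring
open IsIntervalCyclic
open Equivalence using (to; from)

-- Decidability of dependent pairs, functions and least witnesses

-- A family over a decidable type which does not depend on the element of the
-- base has a decidable total space, and decidable sections.
Σ-dec : {A : Set} {B : A → Set} → Dec A → (∀ {x y} → B x → B y) →
        (∀ x → Dec (B x)) → Dec (Σ A B)
Σ-dec (no ¬a) _     _  = no λ (a , _) → ¬a a
Σ-dec (yes a) const B? = map′ (a ,_) (λ (_ , b) → const b) (B? a)

Π-dec : {A : Set} {B : A → Set} → Dec A → (∀ {x y} → B x → B y) →
        (∀ x → Dec (B x)) → Dec (∀ x → B x)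
Π-dec (no ¬a) _     _  = yes λ a → contradiction a ¬a
Π-dec (yes a) const B? = map′ (λ b _ → const b) (λ f → f a) (B? a)

⇔-dec : {A B : Set} → Dec A → Dec B → Dec (A ⇔ B)
⇔-dec A? B? = map′ (λ (f , g) → mk⇔ f g) (λ e → to e , from e)
                   ((A? →-dec B?) ×-dec (B? →-dec A?))

least : {P : ℕ → Set} → Decidable P → ∀ n → P n →
        ∃[ w ] (P w × (∀ t → P t → w ≤ t)) × w ≤ n
least {P} P? = <-rec _ step
  where
  step : ∀ n → (∀ {k} → k < n → P k → ∃[ w ] (P w × (∀ t → P t → w ≤ t)) × w ≤ k) →
         P n → ∃[ w ] (P w × (∀ t → P t → w ≤ t)) × w ≤ n
  step n rec pn with anyUpTo? P? n
  ... | yes (k , k<n , pk) =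
          let w , min , w≤k = rec k<n pk in w , min , ≤-trans w≤k (<⇒≤ k<n)
  ... | no none = n , (pn , λ t pt → ≮⇒≥ λ t<n → none (t , t<n , pt)) , ≤-refl

-- A predicate on tables of colours that respects pointwise equality can be
-- decided by running through the finitely many codes of tables.
anyTable? : ∀ {n t} {P : (Fin n → Fin n → Fin t) → Set} →
            (∀ {f g} → (∀ u v → f u v ≡ g u v) → P f → P g) →
            Decidable P → Dec (∃ P)
anyTable? {n} {t} {P} resp P? =
  map′ (λ (c , p) → decode c , p)
       (λ (f , p) → encode f , resp (λ u v → sym (decode-encode f u v)) p)
       (any? (P? ∘ decode))
  where
  decode : Fin ((t ^ n) ^ n) → Fin n → Fin n → Fin t
  decode c u = finToFun (finToFun c u)

  encode : (Fin n → Fin n → Fin t) → Fin ((t ^ n) ^ n)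
  encode f = funToFin (funToFin ∘ f)

  decode-encode : ∀ f u v → decode (encode f) u v ≡ f u v
  decode-encode f u v =
    trans (cong (λ c → finToFun c v) (finToFun-funToFin (funToFin ∘ f) u))
          (finToFun-funToFin (f u) v)

-- Interval cyclic colourability is decidable

module _ {G : Graph} {t : ℕ} where

  -- The colour of an edge does not depend on the proof of adjacency.
  colour-irrelevant : (α : EdgeColouring G t) → ∀ {u v} (e e′ : Adj G u v) →
                      colour α u v e ≡ colour α u v e′
  colour-irrelevant α e e′ =
    trans (colour-symm α _ _ e (symm G e)) (sym (colour-symm α _ _ e′ (symm G e)))

  -- Equality of colourings, edge by edge.
  _≈_ : (α β : EdgeColouring G t) → Set
  α ≈ β = ∀ u v (e : Adj G u v) → colour α u v e ≡ colour β u v e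

  isIntervalCyclic-resp-≈ : .{{_ : NonZero t}} → ∀ {α β} → α ≈ β →
                            IsIntervalCyclic α → IsIntervalCyclic β
  isIntervalCyclic-resp-≈ {α} {β} α≈β ic = record
    { proper      = λ u v w e f v≢w p →
        proper ic u v w e f v≢w (trans (α≈β u v e) (trans p (sym (α≈β u w f))))
    ; allUsed     = λ c → let u , v , e , p = allUsed ic c in
        u , v , e , trans (sym (α≈β u v e)) p
    ; consecutive = λ v → let s , h = consecutive ic v in
        s , λ c → mk⇔
          (λ (u , e , p) → to (h c) (u , e , trans (α≈β v u e) p))
          (λ i → let u , e , p = from (h c) i in u , e , trans (sym (α≈β v u e)) p)
    }

  module _ (α : EdgeColouring G t) where

    colourIs? : ∀ u v c → Dec (Σ[ e ∈ Adj G u v ] colour α u v e ≡ c)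
    colourIs? u v c = Σ-dec (adj? G u v)
      (λ {e} {e′} → trans (colour-irrelevant α e′ e))
      (λ e → colour α u v e ≟ᶠ c)

    proper? : Dec (Proper α)
    proper? = all? λ u → all? λ v → all? λ w →
      Π-dec (adj? G u v)
        (λ {e} {e′} h f v≢w p → h f v≢w (trans (colour-irrelevant α e e′) p))
        λ e → Π-dec (adj? G u w)
          (λ {f} {f′} h v≢w p → h v≢w (trans p (colour-irrelevant α f′ f)))
          λ f → ¬? (v ≟ᶠ w) →-dec ¬? (colour α u v e ≟ᶠ colour α u w f)

    isIntervalCyclic? : .{{_ : NonZero t}} → Dec (IsIntervalCyclic α)
    isIntervalCyclic? =
      map′ (λ (p , a , c) → record { proper = p ; allUsed = a ; consecutive = c })
           (λ ic → proper ic , allUsed ic , consecutive ic)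
           (proper?
            ×-dec (all? λ c → any? λ u → any? λ v → colourIs? u v c)
            ×-dec (all? λ v → any? λ s → all? λ c →
                     ⇔-dec (any? λ u → colourIs? v u c)
                           (anyUpTo? (λ i → toℕ c ≟ (toℕ s + i) % t) (degree G v))))

  -- The table f has equal entries at (u, v) and (v, u) whenever uv is an edge;
  -- its entries at the other pairs are arbitrary.
  SymmetricTable : (Fin (order G) → Fin (order G) → Fin t) → Set
  SymmetricTable f = ∀ u v → Adj G u v → f u v ≡ f v u

  fromTable : ∀ f → SymmetricTable f → EdgeColouring G t
  fromTable f f-sym = record
    { colour      = λ u v _ → f u v
    ; colour-symm = λ u v e _ → f-sym u v e
    }

  -- The table of a colouring, with the default colour d at the non-adjacent
  -- pairs.
  toTable : Fin t → EdgeColouring G t → Fin (order G) → Fin (order G) → Fin t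
  toTable d α u v with adj? G u v
  ... | yes e = colour α u v e
  ... | no  _ = d

  toTable-colour : ∀ d α u v (e : Adj G u v) → colour α u v e ≡ toTable d α u v
  toTable-colour d α u v e with adj? G u v
  ... | yes e′ = colour-irrelevant α e e′
  ... | no ¬e  = contradiction e ¬e

  toTable-symmetric : ∀ d α → SymmetricTable (toTable d α)
  toTable-symmetric d α u v e =
    trans (sym (toTable-colour d α u v e))
          (trans (colour-symm α u v e (symm G e)) (toTable-colour d α v u (symm G e)))

hasIntervalCyclicColouring? : ∀ G → Decidable (HasIntervalCyclicColouring G)
hasIntervalCyclicColouring? G zero = no λ (0≢0 , _) → contradiction refl (≢-nonZero⁻¹ 0 {{0≢0}})
hasIntervalCyclicColouring? G t@(suc _) =
  map′ (λ (f , f-sym , ic) → _ , fromTable f f-sym , ic)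
       (λ (_ , α , ic) → toTable zero α , toTable-symmetric zero α ,
          isIntervalCyclic-resp-≈ (toTable-colour zero α) ic)
       (anyTable? resp works?)
  where
  -- The table is that of an interval cyclic colouring.
  Works : (Fin (order G) → Fin (order G) → Fin t) → Set
  Works f = Σ[ f-sym ∈ SymmetricTable {G} f ] IsIntervalCyclic (fromTable {G} f f-sym)

  resp : ∀ {f g} → (∀ u v → f u v ≡ g u v) → Works f → Works g
  resp f≗g (f-sym , ic) =
    (λ u v e → trans (sym (f≗g u v)) (trans (f-sym u v e) (f≗g v u))) ,
    isIntervalCyclic-resp-≈ (λ u v _ → f≗g u v) ic

  works? : Decidable Works
  works? f = Σ-dec
    (all? λ u → all? λ v → adj? G u v →-dec (f u v ≟ᶠ f v u))
    (isIntervalCyclic-resp-≈ (λ _ _ _ → refl))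
    (λ f-sym → isIntervalCyclic? (fromTable f f-sym))

-- Modular arithmetic

%-absorbˡ : ∀ m k n .{{_ : NonZero n}} → (m % n + k) % n ≡ (m + k) % n
%-absorbˡ m k n = begin
  (m % n + k) % n         ≡⟨ %-distribˡ-+ (m % n) k n ⟩
  (m % n % n + k % n) % n ≡⟨ cong (λ x → (x + k % n) % n) (m%n%n≡m%n m n) ⟩
  (m % n + k % n) % n     ≡⟨ %-distribˡ-+ m k n ⟨
  (m + k) % n             ∎
  where open ≡-Reasoning

toℕ-mod : ∀ m n .{{_ : NonZero n}} → toℕ (m mod n) ≡ m % n
toℕ-mod m n = toℕ-fromℕ< (m%n<n m n)

-- Adding n - p to p + u recovers u modulo n.
%-cancelˡ : ∀ {n} .{{_ : NonZero n}} {p u v} → p ≤ n → u < n → v < n →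
            (p + u) % n ≡ (p + v) % n → u ≡ v
%-cancelˡ {n} {p} p≤n u<n v<n eq =
  trans (sym (recover u<n)) (trans (cong (λ x → (x + (n ∸ p)) % n) eq) (recover v<n))
  where
  open ≡-Reasoning
  recover : ∀ {w} → w < n → ((p + w) % n + (n ∸ p)) % n ≡ w
  recover {w} w<n = begin
    ((p + w) % n + (n ∸ p)) % n ≡⟨ %-absorbˡ (p + w) (n ∸ p) n ⟩
    (p + w + (n ∸ p)) % n       ≡⟨ cong (λ x → (x + (n ∸ p)) % n) (+-comm p w) ⟩
    (w + p + (n ∸ p)) % n       ≡⟨ cong (_% n) (+-assoc w p (n ∸ p)) ⟩
    (w + (p + (n ∸ p))) % n     ≡⟨ cong (λ x → (w + x) % n) (m+[n∸m]≡n p≤n) ⟩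
    (w + n) % n                 ≡⟨ [m+n]%n≡m%n w n ⟩
    w % n                       ≡⟨ m<n⇒m%n≡m w<n ⟩
    w                           ∎

-- Colouring by addition

-- The number x lies outside the interval [a, b).
Outside : ℕ → ℕ → ℕ → Set
Outside a b x = x < a ⊎ b ≤ x

-- The vertices not adjacent to v are those with numbers in [lo, hi).
record CoInterval (G : Graph) (v : Vertex G) : Set where
  field
    lo hi    : ℕ
    lo≤hi    : lo ≤ hi
    hi≤order : hi ≤ order G
    adj⇔     : ∀ u → Adj G v u ⇔ Outside lo hi (toℕ u)

open CoInterval

¬outside-zero : ∀ {b} → ¬ Outside 0 (suc b) 0
¬outside-zero (inj₁ ())
¬outside-zero (inj₂ ())

-- If P holds of exactly those f 0, …, f (n - 1) whose index is outside [a, b),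
-- then it holds of a + (n - b) of them.
count-outside : ∀ {A : Set} {P : A → Set} (P? : Decidable P) {n} (f : Fin n → A) {a b} →
                a ≤ b → b ≤ n → (∀ i → P (f i) ⇔ Outside a b (toℕ i)) →
                count P? (tabulate f) ≡ a + (n ∸ b)
count-outside P? {zero} f z≤n z≤n h = refl
count-outside P? {suc n} f {zero} {zero} a≤b b≤n h
  rewrite dec-true (P? (f zero)) (from (h zero) (inj₂ z≤n)) =
  cong suc (count-outside P? (f ∘ suc) z≤n z≤n λ i →
    mk⇔ (λ _ → inj₂ z≤n) (λ _ → from (h (suc i)) (inj₂ z≤n)))
count-outside P? {suc n} f {zero} {suc b} a≤b (s≤s b≤n) h
  rewrite dec-false (P? (f zero)) (¬outside-zero ∘ to (h zero)) =
  count-outside P? (f ∘ suc) z≤n b≤n λ i →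
    mk⇔ (λ p → shrink (to (h (suc i)) p)) (λ { (inj₂ q) → from (h (suc i)) (inj₂ (s≤s q)) })
  where
  shrink : ∀ {x} → Outside 0 (suc b) (suc x) → Outside 0 b x
  shrink (inj₂ q) = inj₂ (s≤s⁻¹ q)
count-outside P? {suc n} f {suc a} {suc b} (s≤s a≤b) (s≤s b≤n) h
  rewrite dec-true (P? (f zero)) (from (h zero) (inj₁ (s≤s z≤n))) =
  cong suc (count-outside P? (f ∘ suc) a≤b b≤n λ i →
    mk⇔ (λ p → shrink (to (h (suc i)) p)) (λ o → from (h (suc i)) (grow o)))
  where
  shrink : ∀ {x} → Outside (suc a) (suc b) (suc x) → Outside a b x
  shrink (inj₁ q) = inj₁ (s≤s⁻¹ q)
  shrink (inj₂ q) = inj₂ (s≤s⁻¹ q)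
  grow : ∀ {x} → Outside a b x → Outside (suc a) (suc b) (suc x)
  grow (inj₁ q) = inj₁ (s≤s q)
  grow (inj₂ q) = inj₂ (s≤s q)

coInterval-degree : ∀ {G v} (I : CoInterval G v) → degree G v ≡ lo I + (order G ∸ hi I)
coInterval-degree {G} {v} I = count-outside (adj? G v) id (lo≤hi I) (hi≤order I) (adj⇔ I)

-- The numbers in [b, n) and then those in [0, a) are b, b + 1, … modulo n: the
-- index i is x - b for x ≥ b, and x + (n - b) for x < a.
outside-wraps : ∀ {a b n} .{{_ : NonZero n}} → b ≤ n → ∀ {x} → x < n →
                Outside a b x → ∃[ i ] i < a + (n ∸ b) × (b + i) % n ≡ x
outside-wraps {a} {b} {n} b≤n {x} x<n (inj₁ x<a) =
  x + (n ∸ b) , +-monoˡ-< (n ∸ b) x<a , (begin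
    (b + (x + (n ∸ b))) % n ≡⟨ cong (_% n) (+-assoc b x (n ∸ b)) ⟨
    (b + x + (n ∸ b)) % n   ≡⟨ cong (λ y → (y + (n ∸ b)) % n) (+-comm b x) ⟩
    (x + b + (n ∸ b)) % n   ≡⟨ cong (_% n) (+-assoc x b (n ∸ b)) ⟩
    (x + (b + (n ∸ b))) % n ≡⟨ cong (λ y → (x + y) % n) (m+[n∸m]≡n b≤n) ⟩
    (x + n) % n             ≡⟨ [m+n]%n≡m%n x n ⟩
    x % n                   ≡⟨ m<n⇒m%n≡m x<n ⟩
    x                       ∎)
  where open ≡-Reasoning
outside-wraps {a} {b} {n} b≤n x<n (inj₂ b≤x) =
  _ , <-≤-trans (∸-monoˡ-< x<n b≤x) (m≤n+m (n ∸ b) a) ,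
  trans (cong (_% n) (m+[n∸m]≡n b≤x)) (m<n⇒m%n≡m x<n)

-- Conversely, the a + (n - b) residues from b on avoid [a, b).
wraps-outside : ∀ {a b n} .{{_ : NonZero n}} → a ≤ b → b ≤ n → ∀ {i} →
                i < a + (n ∸ b) → Outside a b ((b + i) % n)
wraps-outside {a} {b} {n} a≤b b≤n {i} i<deg with b + i <? n
... | yes b+i<n = inj₂ (subst (b ≤_) (sym (m<n⇒m%n≡m b+i<n)) (m≤m+n b i))
... | no  b+i≮n with m≤n⇒∃[o]m+o≡n (≮⇒≥ b+i≮n)
...   | j , n+j≡b+i = inj₁ (subst (_< a) (sym wraps) j<a)
  where
  j<a : j < a
  j<a = +-cancelˡ-< n j a (subst (_< n + a) (sym n+j≡b+i) (begin-strict
    b + i             <⟨ +-monoʳ-< b i<deg ⟩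
    b + (a + (n ∸ b)) ≡⟨ cong (b +_) (+-comm a (n ∸ b)) ⟩
    b + (n ∸ b + a)   ≡⟨ +-assoc b (n ∸ b) a ⟨
    b + (n ∸ b) + a   ≡⟨ cong (_+ a) (m+[n∸m]≡n b≤n) ⟩
    n + a             ∎))
    where open ≤-Reasoning
  wraps : (b + i) % n ≡ j
  wraps = begin
    (b + i) % n ≡⟨ cong (_% n) n+j≡b+i ⟨
    (n + j) % n ≡⟨ cong (_% n) (+-comm n j) ⟩
    (j + n) % n ≡⟨ [m+n]%n≡m%n j n ⟩
    j % n       ≡⟨ m<n⇒m%n≡m (<-≤-trans j<a (≤-trans a≤b b≤n)) ⟩
    j           ∎
    where open ≡-Reasoning

module _ (G : Graph) .{{_ : NonZero (order G)}} where

  private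
    N : ℕ
    N = order G

  -- The edge uv has the colour u + v modulo the number of vertices.
  additive : EdgeColouring G N
  additive = record
    { colour      = λ u v _ → (toℕ u + toℕ v) mod N
    ; colour-symm = λ u v _ _ → cong (_mod N) (+-comm (toℕ u) (toℕ v))
    }

  additive-proper : Proper additive
  additive-proper u v w _ _ v≢w eq = v≢w (toℕ-injective
    (%-cancelˡ (<⇒≤ (toℕ<n u)) (toℕ<n v) (toℕ<n w)
      (trans (sym (toℕ-mod _ N)) (trans (cong toℕ eq) (toℕ-mod _ N)))))

  -- The colours at v start with v + hi, where hi is the first number after the
  -- non-neighbours of v.
  additive-consecutive : ∀ {v} → CoInterval G v → CyclicallyConsecutiveAt additive v
  additive-consecutive {v} I = start , λ c → mk⇔ (appears⇒ c) (⇒appears c)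
    where
    open ≡-Reasoning
    p = toℕ v
    b  = hi I

    start : Fin N
    start = (p + b) mod N

    shifted : ∀ i → (p + (b + i) % N) % N ≡ (toℕ start + i) % N
    shifted i = begin
      (p + (b + i) % N) % N ≡⟨ cong (_% N) (+-comm p _) ⟩
      ((b + i) % N + p) % N ≡⟨ %-absorbˡ (b + i) p N ⟩
      (b + i + p) % N       ≡⟨ cong (_% N) (+-comm (b + i) p) ⟩
      (p + (b + i)) % N     ≡⟨ cong (_% N) (+-assoc p b i) ⟨
      (p + b + i) % N       ≡⟨ %-absorbˡ (p + b) i N ⟨
      ((p + b) % N + i) % N ≡⟨ cong (λ s → (s + i) % N) (toℕ-mod (p + b) N) ⟨
      (toℕ start + i) % N   ∎

    appears⇒ : ∀ c → AppearsAt additive v c →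
               ∃[ i ] i < degree G v × toℕ c ≡ (toℕ start + i) % N
    appears⇒ c (u , e , refl) =
      let i , i<deg , b+i≡u = outside-wraps (hi≤order I) (toℕ<n u) (to (adj⇔ I u) e) in
      i , subst (i <_) (sym (coInterval-degree I)) i<deg , (begin
        toℕ ((p + toℕ u) mod N) ≡⟨ toℕ-mod (p + toℕ u) N ⟩
        (p + toℕ u) % N         ≡⟨ cong (λ x → (p + x) % N) b+i≡u ⟨
        (p + (b + i) % N) % N   ≡⟨ shifted i ⟩
        (toℕ start + i) % N     ∎)

    ⇒appears : ∀ c → ∃[ i ] i < degree G v × toℕ c ≡ (toℕ start + i) % N →
               AppearsAt additive v c
    ⇒appears c (i , i<deg , c≡) = u , e , toℕ-injective (begin
        toℕ ((p + toℕ u) mod N) ≡⟨ toℕ-mod (p + toℕ u) N ⟩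
        (p + toℕ u) % N         ≡⟨ cong (λ x → (p + x) % N) (toℕ-mod (b + i) N) ⟩
        (p + (b + i) % N) % N   ≡⟨ shifted i ⟩
        (toℕ start + i) % N     ≡⟨ c≡ ⟨
        toℕ c                   ∎)
      where
      u : Fin N
      u = (b + i) mod N
      e : Adj G v u
      e = from (adj⇔ I u) (subst (Outside (lo I) b) (sym (toℕ-mod (b + i) N))
        (wraps-outside (lo≤hi I) (hi≤order I) (subst (i <_) (coInterval-degree I) i<deg)))

-- The complete tripartite graph

module _ (l m n : ℕ) where

  private
    N : ℕ
    N = l + m + n

    K : Graph
    K = completeTripartite l m n

  -- The part p consists of the vertices with numbers in [first p, last p).
  first last : Fin 3 → ℕ
  first 0F = 0
  first 1F = l
  first 2F = l + m
  last  0F = l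
  last  1F = l + m
  last  2F = N

  first≤last : ∀ p → first p ≤ last p
  first≤last 0F = z≤n
  first≤last 1F = m≤m+n l m
  first≤last 2F = m≤m+n (l + m) n

  last≤N : ∀ p → last p ≤ N
  last≤N 0F = ≤-trans (m≤m+n l m) (m≤m+n (l + m) n)
  last≤N 1F = m≤m+n (l + m) n
  last≤N 2F = ≤-refl

  ∈part : ∀ p (u : Fin N) → first p ≤ toℕ u → toℕ u < last p → part l m n u ≡ p
  ∈part 0F u _ u<l
    rewrite splitAt-< (l + m) u (<-≤-trans u<l (m≤m+n l m))
          | splitAt-< l {m} (fromℕ< (<-≤-trans u<l (m≤m+n l m)))
              (subst (_< l) (sym (toℕ-fromℕ< (<-≤-trans u<l (m≤m+n l m)))) u<l) = refl
  ∈part 1F u l≤u u<l+m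
    rewrite splitAt-< (l + m) u u<l+m
          | splitAt-≥ l {m} (fromℕ< u<l+m) (subst (l ≤_) (sym (toℕ-fromℕ< u<l+m)) l≤u) = refl
  ∈part 2F u l+m≤u _ rewrite splitAt-≥ (l + m) u l+m≤u = refl

  part∋ : ∀ u → first (part l m n u) ≤ toℕ u × toℕ u < last (part l m n u)
  part∋ u with toℕ u <? l | toℕ u <? l + m
  ... | yes u<l | _         rewrite ∈part 0F u z≤n u<l = z≤n , u<l
  ... | no  u≮l | yes u<l+m rewrite ∈part 1F u (≮⇒≥ u≮l) u<l+m = ≮⇒≥ u≮l , u<l+m
  ... | no  _   | no u≮l+m  rewrite ∈part 2F u (≮⇒≥ u≮l+m) (toℕ<n u) = ≮⇒≥ u≮l+m , toℕ<n u

  tripartite-coInterval : ∀ v → CoInterval K v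
  tripartite-coInterval v = record
    { lo       = first p
    ; hi       = last p
    ; lo≤hi    = first≤last p
    ; hi≤order = last≤N p
    ; adj⇔     = λ u → mk⇔ (adj⇒ u) (⇒adj u)
    }
    where
    p : Fin 3
    p = part l m n v

    adj⇒ : ∀ u → Adj K v u → Outside (first p) (last p) (toℕ u)
    adj⇒ u v~u with toℕ u <? first p | toℕ u <? last p
    ... | yes u<first | _        = inj₁ u<first
    ... | no  _       | no u≮last = inj₂ (≮⇒≥ u≮last)
    ... | no  u≮first | yes u<last =
            contradiction (sym (∈part p u (≮⇒≥ u≮first) u<last)) v~u

    ⇒adj : ∀ u → Outside (first p) (last p) (toℕ u) → Adj K v u
    ⇒adj u out p≡q with out | subst (λ q → first q ≤ toℕ u × toℕ u < last q) (sym p≡q) (part∋ u)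
    ... | inj₁ u<first | first≤u , _ = <⇒≱ u<first first≤u
    ... | inj₂ last≤u  | _ , u<last  = <⇒≱ u<last last≤u

  module _ .{{_ : NonZero l}} .{{_ : NonZero m}} .{{_ : NonZero n}} where

    private
      instance
        N≢0 : NonZero N
        N≢0 = >-nonZero (≤-trans (>-nonZero⁻¹ l) (last≤N 0F))

    tripartite-allUsed : UsesAllColours (additive K)
    tripartite-allUsed c with toℕ c <? l
    ... | no c≮l = u , c , u~c , toℕ-injective (begin
        toℕ ((toℕ u + toℕ c) mod N) ≡⟨ toℕ-mod (toℕ u + toℕ c) N ⟩
        (toℕ u + toℕ c) % N         ≡⟨ cong (λ x → (x + toℕ c) % N) u≡0 ⟩
        toℕ c % N                   ≡⟨ m<n⇒m%n≡m (toℕ<n c) ⟩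
        toℕ c                       ∎)
      where
      open ≡-Reasoning
      0<N : 0 < N
      0<N = >-nonZero⁻¹ N
      u : Fin N
      u = fromℕ< 0<N
      u≡0 : toℕ u ≡ 0
      u≡0 = toℕ-fromℕ< 0<N
      u∈0 : part l m n u ≡ 0F
      u∈0 = ∈part 0F u z≤n (subst (_< l) (sym u≡0) (>-nonZero⁻¹ l))
      u~c : Adj K u c
      u~c eq = c≮l (subst (λ p → toℕ c < last p) (trans (sym eq) u∈0) (proj₂ (part∋ c)))
    ... | yes c<l = u , v , u~v , toℕ-injective (begin
        toℕ ((toℕ u + toℕ v) mod N)  ≡⟨ toℕ-mod (toℕ u + toℕ v) N ⟩
        (toℕ u + toℕ v) % N          ≡⟨ cong₂ (λ x y → (x + y) % N) u≡N-1 v≡1+c ⟩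
        (pred N + suc (toℕ c)) % N   ≡⟨ cong (_% N) (+-suc (pred N) (toℕ c)) ⟩
        (suc (pred N) + toℕ c) % N   ≡⟨ cong (λ x → (x + toℕ c) % N) (suc-pred N) ⟩
        (N + toℕ c) % N              ≡⟨ cong (_% N) (+-comm N (toℕ c)) ⟩
        (toℕ c + N) % N              ≡⟨ [m+n]%n≡m%n (toℕ c) N ⟩
        toℕ c % N                    ≡⟨ m<n⇒m%n≡m (toℕ<n c) ⟩
        toℕ c                        ∎)
      where
      open ≡-Reasoning
      l<l+m : l < l + m
      l<l+m = m<m+n l (>-nonZero⁻¹ m)
      N-1<N : pred N < N
      N-1<N = ≤-reflexive (suc-pred N)
      1+c<N : suc (toℕ c) < N
      1+c<N = ≤-<-trans c<l (<-≤-trans l<l+m (m≤m+n (l + m) n))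
      u v : Fin N
      u = fromℕ< N-1<N
      v = fromℕ< 1+c<N
      u≡N-1 : toℕ u ≡ pred N
      u≡N-1 = toℕ-fromℕ< N-1<N
      v≡1+c : toℕ v ≡ suc (toℕ c)
      v≡1+c = toℕ-fromℕ< 1+c<N
      u∈2 : part l m n u ≡ 2F
      u∈2 = ∈part 2F u
        (subst (l + m ≤_) (sym u≡N-1) (<⇒≤pred (m<m+n (l + m) (>-nonZero⁻¹ n))))
        (toℕ<n u)
      -- As c + 1 ≤ l < l + m, the vertex c + 1 is not in the last part.
      u~v : Adj K u v
      u~v eq = <⇒≱ l<l+m (≤-trans
        (subst (λ p → first p ≤ toℕ v) (trans (sym eq) u∈2) (proj₁ (part∋ v)))
        (subst (_≤ l) (sym v≡1+c) c<l))

    tripartite-additive : HasIntervalCyclicColouring K N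
    tripartite-additive = N≢0 , additive K , record
      { proper      = additive-proper K
      ; allUsed     = tripartite-allUsed
      ; consecutive = λ v → additive-consecutive K (tripartite-coInterval v)
      }

theorem31 : (l m n : ℕ) → .{{_ : NonZero l}} → .{{_ : NonZero m}} → .{{_ : NonZero n}} →
    completeTripartite l m n ∈ 𝔑c ×
    (∃[ w ] ((wc[ completeTripartite l m n ]≔ w) × w ≤ l + m + n))
theorem31 l m n =
  (l + m + n , tripartite-additive l m n) ,
  least (hasIntervalCyclicColouring? _) (l + m + n) (tripartite-additive l m n)
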